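{- The satisfiability problem and the finite satisfiability problem for $\mathrm{BGNFO}_1{+}\mathcal{S}$ with inclusions of binary relations are undecidable.
   Context: Signatures are purely relational, $\sigma=\sigma_{\mathrm{base}}\cup\sigma_{\mathrm{dist}}$ with $\sigma_{\mathrm{dist}}=\{T_1,\dots,T_{2k}\}$ binary. GNFO formulas are generated by $\phi ::= B\bar x \mid x=y \mid \phi\wedge\phi \mid \phi\vee\phi \mid \exists x\,\phi \mid \gamma(\bar x,\bar y)\wedge\neg\phi(\bar y)$, where the guard $\gamma$ is an atomic formula containing all free variables of the negated $\phi$. $\mathrm{BGNFO}{+}\mathcal{S}$ consists of such formulas whose guards are atoms over $\sigma_{\mathrm{base}}$ or equalities; admissible structures interpret each $T_u$ as transitive and $T_{2u}$ as the inverse of $T_{2u-1}$. $\mathrm{BGNFO}_1{+}\mathcal{S}$ restricts to one-dimensional formulas (every maximal block of quantifiers leaves at most one variable free). With inclusions of binary relations, the input is additionally a finite set of inclusions $B\subseteq B'$ between binary symbols (transitive or not, e.g. $T\subseteq B$ with $T\in\sigma_{\mathrm{dist}}$, $B\in\sigma_{\mathrm{base}}$), and one asks for an admissible (finite) model satisfying $\forall xy(Bxy\to B'xy)$ for each inclusion. -}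

module Defs where

open import Data.Nat using (ℕ; zero; suc; _+_; _*_; _∸_; _^_; _<_; _≟_)
open import Data.Fin using (Fin)
open import Data.List using (List; []; _∷_; _++_; map)
open import Data.List.Membership.Propositional using (_∈_)
open import Data.List.Relation.Unary.All using (All)
open import Data.Vec using (Vec; lookup) renaming ([] to []ᵥ; _∷_ to _∷ᵥ_)
open import Data.Product using (Σ; _×_; _,_)
open import Data.Sum using (_⊎_)
open import Data.Empty using (⊥)
open import Data.Unit using (⊤)
open import Relation.Nullary using (¬_; yes; no)
open import Relation.Binary.PropositionalEquality using (_≡_)

data PR : ℕ → Set where
  zeroF : ∀ {n} → PR n
  succF : PR 1
  proj  : ∀ {n} → Fin n → PR n
  comp  : ∀ {m n} → PR m → Vec (PR n) m → PR n
  prec  : ∀ {n} → PR n → PR (suc (suc n)) → PR (suc n)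
  mu    : ∀ {n} → PR (suc n) → PR n

data Eval : ∀ {n} → PR n → Vec ℕ n → ℕ → Set
data EvalAll : ∀ {m n} → Vec (PR n) m → Vec ℕ n → Vec ℕ m → Set

data Eval where
  ev-zero : ∀ {n} {xs : Vec ℕ n} → Eval zeroF xs 0
  ev-succ : ∀ {x} → Eval succF (x ∷ᵥ []ᵥ) (suc x)
  ev-proj : ∀ {n} {xs : Vec ℕ n} (i : Fin n) → Eval (proj i) xs (lookup xs i)
  ev-comp : ∀ {m n} {f : PR m} {gs : Vec (PR n) m} {xs ys y} →
            EvalAll gs xs ys → Eval f ys y → Eval (comp f gs) xs y
  ev-prec-zero : ∀ {n} {g : PR n} {h xs y} →
                 Eval g xs y → Eval (prec g h) (0 ∷ᵥ xs) y
  ev-prec-suc  : ∀ {n} {g : PR n} {h xs k r y} →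
                 Eval (prec g h) (k ∷ᵥ xs) r → Eval h (k ∷ᵥ r ∷ᵥ xs) y →
                 Eval (prec g h) (suc k ∷ᵥ xs) y
  ev-mu : ∀ {n} {f : PR (suc n)} {xs k} →
          Eval f (k ∷ᵥ xs) 0 →
          (∀ m → m < k → Σ ℕ (λ r → Eval f (m ∷ᵥ xs) (suc r))) →
          Eval (mu f) xs k

data EvalAll where
  ev-[] : ∀ {n} {xs : Vec ℕ n} → EvalAll []ᵥ xs []ᵥ
  ev-∷  : ∀ {m n} {g : PR n} {gs : Vec (PR n) m} {xs y ys} →
          Eval g xs y → EvalAll gs xs ys → EvalAll (g ∷ᵥ gs) xs (y ∷ᵥ ys)

-- Raw syntax of BGNFO formulas over σ = σ_base ∪ σ_dist.
-- Variables are natural numbers.  Base symbols are indices into the list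
-- of arities of σ_base.  Distinguished symbols T_1,…,T_{2k} are indexed
-- 0,…,2k-1 (index j stands for T_{j+1}).

-- Guards of guarded negations: σ_base atoms or equalities (the "B" in BGNFO).
data Guard : Set where
  gatom : ℕ → List ℕ → Guard
  geq   : ℕ → ℕ → Guard

data Fm : Set where
  batom : ℕ → List ℕ → Fm
  tatom : ℕ → ℕ → ℕ → Fm
  eqF   : ℕ → ℕ → Fm
  andF  : Fm → Fm → Fm
  orF   : Fm → Fm → Fm
  exF   : ℕ → Fm → Fm
  gneg  : Guard → Fm → Fm          -- γ ∧ ¬ φ

data BinSym : Set where
  bsym : ℕ → BinSym
  tsym : ℕ → BinSym

record Instance : Set where
  constructor mkInstance
  field
    arities    : List ℕ
    k          : ℕ
    formula    : Fm
    inclusions : List (BinSym × BinSym)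
open Instance public

remove : ℕ → List ℕ → List ℕ
remove x [] = []
remove x (y ∷ ys) with y ≟ x
... | yes _ = remove x ys
... | no _  = y ∷ remove x ys

guardVars : Guard → List ℕ
guardVars (gatom _ xs) = xs
guardVars (geq x y)    = x ∷ y ∷ []

fv : Fm → List ℕ
fv (batom _ xs)  = xs
fv (tatom _ x y) = x ∷ y ∷ []
fv (eqF x y)     = x ∷ y ∷ []
fv (andF φ ψ)    = fv φ ++ fv ψ
fv (orF φ ψ)     = fv φ ++ fv ψ
fv (exF x φ)     = remove x (fv φ)
fv (gneg g φ)    = guardVars g ++ fv φ

data HasArity : List ℕ → ℕ → ℕ → Set where
  here  : ∀ {a as} → HasArity (a ∷ as) 0 a
  there : ∀ {a as i b} → HasArity as i b → HasArity (a ∷ as) (suc i) b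

length : List ℕ → ℕ
length [] = 0
length (_ ∷ xs) = suc (length xs)

WFGuard : List ℕ → Guard → Set
WFGuard ar (gatom R xs) = HasArity ar R (length xs)
WFGuard ar (geq x y)    = ⊤

WFFm : List ℕ → ℕ → Fm → Set
WFFm ar k (batom R xs)  = HasArity ar R (length xs)
WFFm ar k (tatom j x y) = j < 2 * k
WFFm ar k (eqF x y)     = ⊤
WFFm ar k (andF φ ψ)    = WFFm ar k φ × WFFm ar k ψ
WFFm ar k (orF φ ψ)     = WFFm ar k φ × WFFm ar k ψ
WFFm ar k (exF x φ)     = WFFm ar k φ
WFFm ar k (gneg g φ)    = WFGuard ar g × WFFm ar k φ × All (_∈ guardVars g) (fv φ)

WFBin : List ℕ → ℕ → BinSym → Set
WFBin ar k (bsym R) = HasArity ar R 2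
WFBin ar k (tsym j) = j < 2 * k

AtMostOne : List ℕ → Set
AtMostOne xs = ∀ {a b} → a ∈ xs → b ∈ xs → a ≡ b

-- One-dimensionality: every maximal block of existential quantifiers
-- leaves at most one variable free.
OneDim : Fm → Set
OneDimBlock : Fm → Set
OneDim (batom _ _)   = ⊤
OneDim (tatom _ _ _) = ⊤
OneDim (eqF _ _)     = ⊤
OneDim (andF φ ψ)    = OneDim φ × OneDim ψ
OneDim (orF φ ψ)     = OneDim φ × OneDim ψ
OneDim (exF x φ)     = AtMostOne (fv (exF x φ)) × OneDimBlock φ
OneDim (gneg _ φ)    = OneDim φ
OneDimBlock (exF _ φ) = OneDimBlock φ
OneDimBlock φ         = OneDim φ

Sentence : Fm → Set
Sentence φ = fv φ ≡ []

WFInstance : Instance → Set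
WFInstance I =
  WFFm (arities I) (k I) (formula I) × Sentence (formula I) × OneDim (formula I) ×
  All (λ p → WFBin (arities I) (k I) (Data.Product.proj₁ p) ×
             WFBin (arities I) (k I) (Data.Product.proj₂ p)) (inclusions I)

record Structure (A : Set) : Set₁ where
  field
    base : ℕ → List A → Set
    dist : ℕ → A → A → Set
open Structure public

_[_↦_] : {A : Set} → (ℕ → A) → ℕ → A → (ℕ → A)
(ρ [ x ↦ a ]) y with y ≟ x
... | yes _ = a
... | no _  = ρ y

GSat : {A : Set} → Structure A → (ℕ → A) → Guard → Set
GSat M ρ (gatom R xs) = base M R (map ρ xs)
GSat M ρ (geq x y)    = ρ x ≡ ρ y

Sat : {A : Set} → Structure A → (ℕ → A) → Fm → Set
Sat M ρ (batom R xs)  = base M R (map ρ xs)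
Sat M ρ (tatom j x y) = dist M j (ρ x) (ρ y)
Sat M ρ (eqF x y)     = ρ x ≡ ρ y
Sat M ρ (andF φ ψ)    = Sat M ρ φ × Sat M ρ ψ
Sat M ρ (orF φ ψ)     = Sat M ρ φ ⊎ Sat M ρ ψ
Sat {A} M ρ (exF x φ) = Σ A (λ a → Sat M (ρ [ x ↦ a ]) φ)
Sat M ρ (gneg g φ)    = GSat M ρ g × ¬ Sat M ρ φ

-- Admissible: each T_u transitive, and T_{2u} the inverse of T_{2u-1}
-- (0-based: index 2u+1 is the inverse of index 2u, for u < k).
Admissible : {A : Set} → ℕ → Structure A → Set
Admissible {A} k M =
  (∀ j → j < 2 * k → ∀ {x y z : A} → dist M j x y → dist M j y z → dist M j x z) ×
  (∀ u → u < k → ∀ {x y : A} →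
     (dist M (suc (2 * u)) x y → dist M (2 * u) y x) ×
     (dist M (2 * u) y x → dist M (suc (2 * u)) x y))

BinInterp : {A : Set} → Structure A → BinSym → A → A → Set
BinInterp M (bsym R) x y = base M R (x ∷ y ∷ [])
BinInterp M (tsym j) x y = dist M j x y

SatInclusions : {A : Set} → Structure A → List (BinSym × BinSym) → Set
SatInclusions M incs =
  All (λ p → ∀ x y → BinInterp M (Data.Product.proj₁ p) x y →
                     BinInterp M (Data.Product.proj₂ p) x y) incs

-- I has a model in structures with carrier A (domain nonempty via ρ)
ModelOn : Instance → (A : Set) → Set₁
ModelOn I A = Σ (Structure A) (λ M →
  Admissible (k I) M × SatInclusions M (inclusions I) ×
  Σ (ℕ → A) (λ ρ → Sat M ρ (formula I)))

Satisfiable : Instance → Set₁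
Satisfiable I = Σ Set (λ A → ModelOn I A)

FinSatisfiable : Instance → Set₁
FinSatisfiable I = Σ ℕ (λ n → ModelOn I (Fin n))

pair : ℕ → ℕ → ℕ
pair a b = 2 ^ a * suc (2 * b) ∸ 1

codeList : List ℕ → ℕ
codeList [] = 0
codeList (x ∷ xs) = suc (pair x (codeList xs))

codeGuard : Guard → ℕ
codeGuard (gatom R xs) = pair 0 (pair R (codeList xs))
codeGuard (geq x y)    = pair 1 (pair x y)

codeFm : Fm → ℕ
codeFm (batom R xs)  = pair 0 (pair R (codeList xs))
codeFm (tatom j x y) = pair 1 (pair j (pair x y))
codeFm (eqF x y)     = pair 2 (pair x y)
codeFm (andF φ ψ)    = pair 3 (pair (codeFm φ) (codeFm ψ))
codeFm (orF φ ψ)     = pair 4 (pair (codeFm φ) (codeFm ψ))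
codeFm (exF x φ)     = pair 5 (pair x (codeFm φ))
codeFm (gneg g φ)    = pair 6 (pair (codeGuard g) (codeFm φ))

codeBin : BinSym → ℕ
codeBin (bsym R) = pair 0 R
codeBin (tsym j) = pair 1 j

codeIncs : List (BinSym × BinSym) → ℕ
codeIncs [] = 0
codeIncs ((b , b') ∷ is) = suc (pair (pair (codeBin b) (codeBin b')) (codeIncs is))

codeInstance : Instance → ℕ
codeInstance I =
  pair (codeList (arities I)) (pair (k I) (pair (codeFm (formula I)) (codeIncs (inclusions I))))

Decides : PR 1 → (Instance → Set₁) → Set₁
Decides f P = ∀ I → WFInstance I →
  (P I → Eval f (codeInstance I ∷ᵥ []ᵥ) 1) × (¬ P I → Eval f (codeInstance I ∷ᵥ []ᵥ) 0)

Decidable : (Instance → Set₁) → Set₁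
Decidable P = Σ (PR 1) (λ f → Decides f P)

{-# OPTIONS --safe #-}
module Submission where

open import Defs hiding (length)
open import Data.Empty using (⊥; ⊥-elim)
open import Data.Fin using (Fin; zero; suc; toℕ)
open import Data.List using (List; []; _∷_; _++_; length; replicate; lookup)
open import Data.List.Membership.Propositional using (_∈_)
open import Data.List.Membership.Propositional.Properties using (∈-++⁺ˡ; ∈-++⁺ʳ)
open import Data.List.Relation.Unary.All as All using (All; []; _∷_)
open import Data.List.Relation.Unary.All.Properties using (++⁺; ++⁻ˡ; ++⁻ʳ)
open import Data.List.Relation.Unary.Any using (here; there; index)
open import Data.List.Relation.Unary.Any.Properties using (lookup-index)
open import Data.Nat using (ℕ; zero; suc; _+_; _*_; _^_; _≤_; _<_; z≤n; s≤s; _≟_)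
open import Data.Nat.Properties
open import Data.Product using (Σ; ∃; _×_; _,_; proj₁; proj₂)
open import Data.Sum using (inj₁)
open import Data.Unit using (⊤; tt)
open import Data.Vec as Vec using (Vec; []; _∷_)
open import Function using (_∘_; id)
open import Relation.Nullary using (¬_; yes; no)
open import Relation.Binary.PropositionalEquality

-- Given p : PR 1, compile p ∘ instP to a while-program t on binary trees and let c
-- be the code of the formula coreF t; applied to c, this program runs p on (the code
-- of) the instance I made of coreF t and a description of the number c.  I has no model
-- if the program returns a nonzero number, and a finite model if it returns 0.  Hence p
-- is wrong about I, for satisfiability as well as for finite satisfiability.
--
-- The inclusion T₁ ⊆ T₂ = T₁⁻¹ makes the transitive T₁ an equivalence on the relevant
-- elements, and T₁ ⊆ E turns E into a guard for any two of them.  So quantifier-free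
-- Horn clauses over binary relations and ∀∃-sentences are expressible, and these
-- axiomatise the runs of t: elements stand for trees, D t marks the inputs on which
-- subprogram t has to be run, and R t is its input–output relation.  A halting run
-- creates finitely many trees, and these form the finite model.

-- Arithmetic of the pairing function

1+pair : ∀ a b → 2 ^ a * suc (2 * b) ≡ suc (pair a b)
1+pair a b with 2 ^ a * suc (2 * b) in eq
... | suc n = refl
... | zero with m*n≡0⇒m≡0∨n≡0 (2 ^ a) eq
...   | inj₁ e = ⊥-elim (<⇒≢ (m^n>0 2 a) (sym e))

pair-zero : ∀ b → pair 0 b ≡ 2 * b
pair-zero b = suc-injective (trans (sym (1+pair 0 b)) (+-identityʳ _))

-- With `pair-zero` this gives a recursion in the first argument. Injectivity then follows by parity
-- and induction, and `pairingP` computes `pair` by the same recursion.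
pair-suc : ∀ a b → pair (suc a) b ≡ suc (2 * pair a b)
pair-suc a b = suc-injective (begin
  suc (pair (suc a) b)           ≡⟨ 1+pair (suc a) b ⟨
  2 * 2 ^ a * suc (2 * b)        ≡⟨ *-assoc 2 (2 ^ a) _ ⟩
  2 * (2 ^ a * suc (2 * b))      ≡⟨ cong (2 *_) (1+pair a b) ⟩
  2 * suc (pair a b)             ≡⟨ cong suc (+-suc (pair a b) _) ⟩
  suc (suc (2 * pair a b))       ∎)
  where open ≡-Reasoning

pair-injective : ∀ a a' {b b'} → pair a b ≡ pair a' b' → a ≡ a' × b ≡ b'
pair-injective zero zero {b} {b'} e =
  refl , *-cancelˡ-≡ b b' 2 (trans (sym (pair-zero b)) (trans e (pair-zero b')))
pair-injective zero (suc a') {b} {b'} e =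
  ⊥-elim (even≢odd b (pair a' b') (trans (sym (pair-zero b)) (trans e (pair-suc a' b'))))
pair-injective (suc a) zero {b} {b'} e =
  ⊥-elim (even≢odd b' (pair a b) (trans (sym (pair-zero b')) (trans (sym e) (pair-suc a b))))
pair-injective (suc a) (suc a') {b} {b'} e
  with pair-injective a a' (*-cancelˡ-≡ (pair a b) (pair a' b') 2
         (suc-injective (trans (sym (pair-suc a b)) (trans e (pair-suc a' b')))))
... | refl , q = refl , q

pair-mono-≤ : ∀ {a a' b b'} → a ≤ a' → b ≤ b' → pair a b ≤ pair a' b'
pair-mono-≤ a≤a' b≤b' =
  ∸-monoˡ-≤ 1 (*-mono-≤ (^-monoʳ-≤ 2 a≤a') (s≤s (*-monoʳ-≤ 2 b≤b')))

n≤2*n : ∀ n → n ≤ 2 * n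
n≤2*n n = m≤m+n n _

≤-pairʳ : ∀ a b → b ≤ pair a b
≤-pairʳ zero    b = ≤-trans (n≤2*n b) (≤-reflexive (sym (pair-zero b)))
≤-pairʳ (suc a) b = begin
  b                   ≤⟨ ≤-pairʳ a b ⟩
  pair a b            ≤⟨ n≤2*n _ ⟩
  2 * pair a b        ≤⟨ n≤1+n _ ⟩
  suc (2 * pair a b)  ≡⟨ pair-suc a b ⟨
  pair (suc a) b      ∎
  where open ≤-Reasoning

≤-pairˡ : ∀ a b → a ≤ pair a b
≤-pairˡ zero    b = z≤n
≤-pairˡ (suc a) b = begin
  suc a               ≤⟨ s≤s (≤-trans (≤-pairˡ a b) (n≤2*n _)) ⟩
  suc (2 * pair a b)  ≡⟨ pair-suc a b ⟨
  pair (suc a) b      ∎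
  where open ≤-Reasoning

-- A while-language on binary trees

data Tree : Set where
  leaf : Tree
  node : Tree → Tree → Tree

num : ℕ → Tree
num zero    = leaf
num (suc n) = node leaf (num n)

data Tm : Set where
  leafT idT leftT rightT : Tm
  pairT compT            : Tm → Tm → Tm
  whileT                 : Tm → Tm

variable
  t f g : Tm
  a b v w : Tree
  P Q : Tree → Set

-- P constrains the trees that a run may create; it is used to run inside a
-- finite set of trees.
data Ev (P : Tree → Set) : Tm → Tree → Tree → Set where
  ev-leaf  : P leaf → Ev P leafT v leaf
  ev-id    : Ev P idT v v
  ev-left  : Ev P leftT (node a b) a
  ev-right : Ev P rightT (node a b) b
  ev-pair  : P (node a b) → Ev P f v a → Ev P g v b → Ev P (pairT f g) v (node a b)
  ev-comp  : Ev P f v a → Ev P g a w → Ev P (compT g f) v w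
  ev-stop  : Ev P (whileT f) (node leaf v) v
  ev-step  : ∀ {u} → Ev P f (node (node a b) v) u → Ev P (whileT f) u w →
             Ev P (whileT f) (node (node a b) v) w

ev-deterministic : Ev P t v a → Ev P t v b → a ≡ b
ev-deterministic (ev-leaf _)     (ev-leaf _)     = refl
ev-deterministic ev-id           ev-id           = refl
ev-deterministic ev-left         ev-left         = refl
ev-deterministic ev-right        ev-right        = refl
ev-deterministic (ev-pair _ d e) (ev-pair _ d' e') =
  cong₂ node (ev-deterministic d d') (ev-deterministic e e')
ev-deterministic (ev-comp d e)   (ev-comp d' e') with ev-deterministic d d'
... | refl = ev-deterministic e e'
ev-deterministic ev-stop         ev-stop         = refl
ev-deterministic (ev-step d e)   (ev-step d' e') with ev-deterministic d d'
... | refl = ev-deterministic e e'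

ev-map : (∀ {u} → P u → Q u) → Ev P t v w → Ev Q t v w
ev-map h (ev-leaf p)     = ev-leaf (h p)
ev-map h ev-id           = ev-id
ev-map h ev-left         = ev-left
ev-map h ev-right        = ev-right
ev-map h (ev-pair p d e) = ev-pair (h p) (ev-map h d) (ev-map h e)
ev-map h (ev-comp d e)   = ev-comp (ev-map h d) (ev-map h e)
ev-map h ev-stop         = ev-stop
ev-map h (ev-step d e)   = ev-step (ev-map h d) (ev-map h e)

Run : Tm → Tree → Tree → Set
Run = Ev (λ _ → ⊤)

run-pair : Run f v a → Run g v b → Run (pairT f g) v (node a b)
run-pair = ev-pair tt

-- A derivation is finite, so the trees built by its `ev-leaf` and `ev-pair` steps can be listed.
-- They will be part of the carrier of the finite model.
run-support : Run t v w → Σ (List Tree) λ L → Ev (_∈ L) t v w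
run-support (ev-leaf _)  = leaf ∷ [] , ev-leaf (here refl)
run-support ev-id        = [] , ev-id
run-support ev-left      = [] , ev-left
run-support ev-right     = [] , ev-right
run-support (ev-pair {a = a} {b = b} _ d e) with run-support d | run-support e
... | L , d' | L' , e' = node a b ∷ L ++ L' ,
  ev-pair (here refl) (ev-map (there ∘ ∈-++⁺ˡ) d') (ev-map (there ∘ ∈-++⁺ʳ L) e')
run-support (ev-comp d e) with run-support d | run-support e
... | L , d' | L' , e' = L ++ L' , ev-comp (ev-map ∈-++⁺ˡ d') (ev-map (∈-++⁺ʳ L) e')
run-support ev-stop      = [] , ev-stop
run-support (ev-step d e) with run-support d | run-support e
... | L , d' | L' , e' = L ++ L' , ev-step (ev-map ∈-++⁺ˡ d') (ev-map (∈-++⁺ʳ L) e')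

-- Compilation of recursive functions

nums : ∀ {n} → Vec ℕ n → Tree
nums []       = leaf
nums (x ∷ xs) = node (num x) (nums xs)

sucT : Tm → Tm
sucT = pairT leafT

projT : ∀ {n} → Fin n → Tm
projT zero    = leftT
projT (suc i) = compT (projT i) rightT

-- Loop state (k , (i , (r , xs))): k rounds are left, and r is the value at i.
precBody : Tm → Tm
precBody h = pairT (compT rightT leftT)
  (pairT (sucT (compT leftT rightT))
    (pairT (compT h rightT) (compT rightT (compT rightT rightT))))

-- Loop state (r , (m , xs)): r is the value at m − 1 (nonzero in the initial state).
muBody : Tm → Tm
muBody f = pairT (compT f rightT)
  (pairT (sucT (compT leftT rightT)) (compT rightT rightT))

compile    : ∀ {n} → PR n → Tm
compileAll : ∀ {m n} → Vec (PR n) m → Tm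
compile zeroF       = leafT
compile succF       = sucT leftT
compile (proj i)    = projT i
compile (comp f gs) = compT (compile f) (compileAll gs)
compile (prec g h)  = compT (compT leftT rightT) (compT (whileT (precBody (compile h)))
  (pairT leftT (pairT leafT (pairT (compT (compile g) rightT) rightT))))
-- On exit the counter has already moved past the zero of `f`, so `rightT` takes the predecessor of
-- the first entry.
compile (mu f)      = compT (compT rightT leftT) (compT (whileT (muBody (compile f)))
  (pairT (sucT leafT) (pairT leafT idT)))
compileAll []       = leafT
compileAll (g ∷ gs) = pairT (compile g) (compileAll gs)

-- Correctness of the compiled programs

run-proj : ∀ {n} (xs : Vec ℕ n) i → Run (projT i) (nums xs) (num (Vec.lookup xs i))
run-proj (x ∷ xs) zero    = ev-left
run-proj (x ∷ xs) (suc i) = ev-comp ev-right (run-proj xs i)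

precState : ∀ {n} → ℕ → ℕ → ℕ → Vec ℕ n → Tree
precState k i r xs = node (num k) (nums (i ∷ r ∷ xs))

muState : ∀ {n} → ℕ → ℕ → Vec ℕ n → Tree
muState r m xs = node (num r) (nums (m ∷ xs))

run-muBody : ∀ {n m r r'} {xs : Vec ℕ n} → Run f (nums (m ∷ xs)) (num r') →
             Run (muBody f) (muState r m xs) (muState r' (suc m) xs)
run-muBody d = run-pair (ev-comp ev-right d)
  (run-pair (run-pair (ev-leaf tt) (ev-comp ev-right ev-left)) (ev-comp ev-right ev-right))

-- Induction on `j`, the distance from the current counter `i` to the zero. The nonzero value in the
-- state forces a further round, and the last round increments the counter once more.
run-mu : ∀ {n} {xs : Vec ℕ n} j i r → Run f (nums (j + i ∷ xs)) leaf →
         (∀ m → m < j + i → Σ ℕ λ r → Run f (nums (m ∷ xs)) (num (suc r))) →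
         Run (whileT (muBody f)) (muState (suc r) i xs) (nums (suc (j + i) ∷ xs))
run-mu zero    i r d h = ev-step (run-muBody {r = suc r} {r' = 0} d) ev-stop
run-mu {f = f} {xs = xs} (suc j) i r d h with h i (s≤s (m≤n+m i j))
... | r' , e = ev-step (run-muBody {r = suc r} {r' = suc r'} e)
  (subst (λ k → Run (whileT (muBody f)) (muState (suc r') (suc i) xs) (nums (suc k ∷ xs)))
    (+-suc j i)
    (run-mu j (suc i) r' (subst (λ k → Run f (nums (k ∷ xs)) leaf) (sym (+-suc j i)) d)
      (λ m m< → h m (subst (m <_) (+-suc j i) m<))))

run-compile    : ∀ {n} {p : PR n} {xs y} → Eval p xs y → Run (compile p) (nums xs) (num y)
run-compileAll : ∀ {m n} {ps : Vec (PR n) m} {xs ys} → EvalAll ps xs ys →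
                 Run (compileAll ps) (nums xs) (nums ys)
run-compileΣ   : ∀ {n} {p : PR n} {xs} → Σ ℕ (λ r → Eval p xs (suc r)) →
                 Σ ℕ (λ r → Run (compile p) (nums xs) (num (suc r)))
-- The evaluation unfolds from stage `k` down to 0, whereas the loop runs upwards. So the run from
-- stage `k` on is given as a continuation and is prolonged backwards, one round for each level of
-- the evaluation.
run-prec       : ∀ {n} {g : PR n} {h k xs r w} j → Eval (prec g h) (k ∷ xs) r →
                 Run (whileT (precBody (compile h))) (precState j k r xs) w →
                 Σ ℕ λ s → Run (compile g) (nums xs) (num s) ×
                   Run (whileT (precBody (compile h))) (precState (k + j) 0 s xs) w

run-compile ev-zero             = ev-leaf tt
run-compile ev-succ             = run-pair (ev-leaf tt) ev-left
run-compile {xs = xs} (ev-proj i) = run-proj xs i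
run-compile (ev-comp ds d)      = ev-comp (run-compileAll ds) (run-compile d)
run-compile (ev-prec-zero d)    = ev-comp
  (ev-comp (run-pair ev-left (run-pair (ev-leaf tt) (run-pair (ev-comp ev-right (run-compile d)) ev-right)))
    ev-stop)
  (ev-comp ev-right ev-left)
-- With no rounds left the loop stops at once; this is the continuation to start from.
run-compile {p = prec g h} {xs = suc k ∷ xs} {y} e@(ev-prec-suc _ _) with run-prec 0 e ev-stop
... | s , d , loop = ev-comp
  (ev-comp (run-pair ev-left (run-pair (ev-leaf tt) (run-pair (ev-comp ev-right d) ev-right)))
    (subst (λ i → Run (whileT (precBody (compile h))) (precState i 0 s xs) (nums (suc k ∷ y ∷ xs)))
      (+-identityʳ (suc k)) loop))
  (ev-comp ev-right ev-left)
run-compile {xs = xs} (ev-mu {f = f} {k = k} d h) = ev-comp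
  (ev-comp (run-pair (run-pair (ev-leaf tt) (ev-leaf tt)) (run-pair (ev-leaf tt) ev-id))
    (subst (λ i → Run _ (muState 1 0 xs) (nums (suc i ∷ xs))) (+-identityʳ k)
      (run-mu k 0 0 (subst (λ i → Run (compile f) (nums (i ∷ xs)) leaf) (sym (+-identityʳ k)) (run-compile d))
        (λ m m< → run-compileΣ (h m (subst (m <_) (+-identityʳ k) m<))))))
  (ev-comp ev-left ev-right)

run-compileAll ev-[]       = ev-leaf tt
run-compileAll (ev-∷ d ds) = run-pair (run-compile d) (run-compileAll ds)

run-compileΣ (r , d) = r , run-compile d

run-prec j (ev-prec-zero d)  loop = _ , run-compile d , loop
run-prec {h = h} {k = suc k} {xs = xs} {w = w} j (ev-prec-suc e d) loop
  with run-prec (suc j) e (ev-step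
         (run-pair (ev-comp ev-left ev-right)
           (run-pair (run-pair (ev-leaf tt) (ev-comp ev-right ev-left))
             (run-pair (ev-comp ev-right (run-compile d))
               (ev-comp (ev-comp ev-right ev-right) ev-right))))
         loop)
... | s , d' , loop' = s , d' ,
  subst (λ i → Run (whileT (precBody (compile h))) (precState i 0 s xs) w) (+-suc k j) loop'

-- Symbols, clauses, and their formulas

tag codeArg code : Tm → ℕ
tag leafT        = 0
tag idT          = 1
tag leftT        = 2
tag rightT       = 3
tag (pairT _ _)  = 4
tag (compT _ _)  = 5
tag (whileT _)   = 6
codeArg (pairT f g) = pair (code f) (code g)
codeArg (compT g f) = pair (code g) (code f)
codeArg (whileT f)  = code f
codeArg _           = 0
code t = pair (tag t) (codeArg t)

-- Needed in the finite model, where the number of a relation symbol has to determine the symbol and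
-- hence the program it speaks about.
code-injective : ∀ t t' → code t ≡ code t' → t ≡ t'
tag-codeArg-injective : ∀ t t' → tag t ≡ tag t' → codeArg t ≡ codeArg t' → t ≡ t'
code-injective t t' e with pair-injective (tag t) (tag t') e
... | p , q = tag-codeArg-injective t t' p q
tag-codeArg-injective leafT       leafT         _ _ = refl
tag-codeArg-injective idT         idT           _ _ = refl
tag-codeArg-injective leftT       leftT         _ _ = refl
tag-codeArg-injective rightT      rightT        _ _ = refl
tag-codeArg-injective (pairT f g) (pairT f' g') _ q with pair-injective (code f) (code f') q
... | p , r = cong₂ pairT (code-injective f f' p) (code-injective g g' r)
tag-codeArg-injective (compT f g) (compT f' g') _ q with pair-injective (code f) (code f') q
... | p , r = cong₂ compT (code-injective f f' p) (code-injective g g' r)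
tag-codeArg-injective (whileT f)  (whileT f')   _ q = cong whileT (code-injective f f' q)

-- Every symbol is binary; a unary predicate Leaf, Start or D is read off the
-- diagonal.  D t x says that the value of t at x is required, R t x y that it is y.
data Sym : Set where
  E Leaf Fst Snd Start : Sym
  D R                  : Tm → Sym

symTag symArg : Sym → ℕ
symTag E      = 0
symTag Leaf   = 1
symTag Fst    = 2
symTag Snd    = 3
symTag Start  = 4
symTag (D _)  = 5
symTag (R _)  = 6
symArg (D t)  = code t
symArg (R t)  = code t
symArg _      = 0

symTag-symArg-injective : ∀ s s' → symTag s ≡ symTag s' → symArg s ≡ symArg s' → s ≡ s'
symTag-symArg-injective E     E      _ _ = refl
symTag-symArg-injective Leaf  Leaf   _ _ = refl
symTag-symArg-injective Fst   Fst    _ _ = refl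
symTag-symArg-injective Snd   Snd    _ _ = refl
symTag-symArg-injective Start Start  _ _ = refl
symTag-symArg-injective (D t) (D t') _ q = cong D (code-injective t t' q)
symTag-symArg-injective (R t) (R t') _ q = cong R (code-injective t t' q)

symTag≤6 : ∀ s → symTag s ≤ 6
symTag≤6 E     = z≤n
symTag≤6 Leaf  = s≤s z≤n
symTag≤6 Fst   = s≤s (s≤s z≤n)
symTag≤6 Snd   = s≤s (s≤s (s≤s z≤n))
symTag≤6 Start = s≤s (s≤s (s≤s (s≤s z≤n)))
symTag≤6 (D _) = s≤s (s≤s (s≤s (s≤s (s≤s z≤n))))
symTag≤6 (R _) = ≤-refl

-- Abstract, since unfolding these numbers makes conversion checking explode.
abstract
  ⌜_⌝ : Sym → ℕ
  ⌜ s ⌝ = pair (symTag s) (symArg s)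

  ⌜⌝-injective : ∀ s s' → ⌜ s ⌝ ≡ ⌜ s' ⌝ → s ≡ s'
  ⌜⌝-injective s s' e with pair-injective (symTag s) (symTag s') e
  ... | p , q = symTag-symArg-injective s s' p q

  ⌜⌝≤ : ∀ {K} s → symArg s ≤ K → ⌜ s ⌝ ≤ pair 6 K
  ⌜⌝≤ {K} s p = pair-mono-≤ {symTag s} {6} {symArg s} {K} (symTag≤6 s) p

Var : Set
Var = Fin 5

Atom : Set
Atom = Sym × Var × Var

-- `total s s'` asks for an `s'`-successor of each `x` on the diagonal of `s`. That successor must
-- also be a `T₁`-successor, so that it stays among the elements any two of which can be guarded.
data Clause : Set where
  horn   : List Atom → Atom → Clause
  denial : List Atom → Clause
  total  : Sym → Sym → Clause

atomF : Atom → Fm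
atomF (s , i , j) = batom ⌜ s ⌝ (toℕ i ∷ toℕ j ∷ [])

-- A negated binary atom needs a base guard; `E` serves because it holds between any two elements of
-- the relevant `T₁`-class.
notAtomF : Atom → Fm
notAtomF (s , i , j) = gneg (gatom ⌜ E ⌝ (toℕ i ∷ toℕ j ∷ [])) (atomF (s , i , j))

conjF : List Atom → Fm → Fm
conjF []       φ = φ
conjF (x ∷ xs) φ = andF (atomF x) (conjF xs φ)

-- A single block binding all variables of a clause leaves none free, so the matrix may relate five
-- elements without violating one-dimensionality.
ex5F : Fm → Fm
ex5F φ = exF 0 (exF 1 (exF 2 (exF 3 (exF 4 φ))))

-- For a sentence the trivial equality is a legal guard; quantifying its variable makes the result a
-- sentence again.
notF : Fm → Fm
notF φ = exF 0 (gneg (geq 0 0) φ)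

violationF : Clause → Fm
violationF (horn xs x)  = ex5F (conjF xs (notAtomF x))
violationF (denial xs)  = ex5F (conjF xs (eqF 0 0))
-- The inner block leaves only variable 0 free, and the guard on the diagonal of `s` contains it.
violationF (total s s') = exF 0 (gneg (gatom ⌜ s ⌝ (0 ∷ 0 ∷ []))
  (exF 1 (andF (batom ⌜ s' ⌝ (0 ∷ 1 ∷ [])) (tatom 0 0 1))))

clauseF : Clause → Fm
clauseF c = notF (violationF c)

-- Syntactic conditions

∈[]⇒≡[] : ∀ {xs : List ℕ} → All (_∈ []) xs → xs ≡ []
∈[]⇒≡[] []       = refl
∈[]⇒≡[] (() ∷ _)

remove-∈ : ∀ x {ys xs} → All (_∈ (x ∷ ys)) xs → All (_∈ ys) (remove x xs)
remove-∈ x []               = []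
remove-∈ x {xs = z ∷ _} (p ∷ ps) with z ≟ x | p
... | yes _ | _       = remove-∈ x ps
... | no ¬e | here e  = ⊥-elim (¬e e)
... | no _  | there q = q ∷ remove-∈ x ps

atMostOne-[] : ∀ {xs} → xs ≡ [] → AtMostOne xs
atMostOne-[] refl ()

atMostOne-∈ : ∀ {x xs} → All (_∈ (x ∷ [])) xs → AtMostOne xs
atMostOne-∈ ps p q with All.lookup ps p | All.lookup ps q
... | here e | here e' = trans e (sym e')

vars : List ℕ
vars = 4 ∷ 3 ∷ 2 ∷ 1 ∷ 0 ∷ []

toℕ∈vars : (i : Var) → toℕ i ∈ vars
toℕ∈vars zero                         = there (there (there (there (here refl))))
toℕ∈vars (suc zero)                   = there (there (there (here refl)))
toℕ∈vars (suc (suc zero))             = there (there (here refl))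
toℕ∈vars (suc (suc (suc zero)))       = there (here refl)
toℕ∈vars (suc (suc (suc (suc zero)))) = here refl

fv-atomF : ∀ x → All (_∈ vars) (fv (atomF x))
fv-atomF (s , i , j) = toℕ∈vars i ∷ toℕ∈vars j ∷ []

fv-notAtomF : ∀ x → All (_∈ vars) (fv (notAtomF x))
fv-notAtomF (s , i , j) = toℕ∈vars i ∷ toℕ∈vars j ∷ toℕ∈vars i ∷ toℕ∈vars j ∷ []

fv-conjF : ∀ xs φ → All (_∈ vars) (fv φ) → All (_∈ vars) (fv (conjF xs φ))
fv-conjF []       φ p = p
fv-conjF (x ∷ xs) φ p = ++⁺ (fv-atomF x) (fv-conjF xs φ p)

fv-ex5F : ∀ φ → All (_∈ vars) (fv φ) → fv (ex5F φ) ≡ []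
fv-ex5F φ p = ∈[]⇒≡[] (remove-∈ 0 (remove-∈ 1 (remove-∈ 2 (remove-∈ 3 (remove-∈ 4 p)))))

fv-violationF : ∀ c → fv (violationF c) ≡ []
fv-violationF (horn xs x)  = fv-ex5F (conjF xs (notAtomF x)) (fv-conjF xs (notAtomF x) (fv-notAtomF x))
fv-violationF (denial xs)  = fv-ex5F (conjF xs (eqF 0 0))
  (fv-conjF xs (eqF 0 0) (toℕ∈vars zero ∷ toℕ∈vars zero ∷ []))
fv-violationF (total s s') = refl

fv-clauseF : ∀ c → fv (clauseF c) ≡ []
fv-clauseF c rewrite fv-violationF c = refl

oneDim-conjF : ∀ xs φ → OneDim φ → OneDim (conjF xs φ)
oneDim-conjF []       φ p = p
oneDim-conjF (x ∷ xs) φ p = tt , oneDim-conjF xs φ p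

oneDimBlock-conjF : ∀ xs φ → OneDim φ → OneDimBlock φ → OneDimBlock (conjF xs φ)
oneDimBlock-conjF []       φ p q = q
oneDimBlock-conjF (x ∷ xs) φ p q = tt , oneDim-conjF xs φ p

oneDim-violationF : ∀ c → OneDim (violationF c)
oneDim-violationF c@(horn xs x) =
  atMostOne-[] (fv-violationF c) , oneDimBlock-conjF xs (notAtomF x) tt tt
oneDim-violationF c@(denial xs) =
  atMostOne-[] (fv-violationF c) , oneDimBlock-conjF xs (eqF 0 0) tt tt
oneDim-violationF (total s s') =
  atMostOne-[] refl , atMostOne-∈ (here refl ∷ here refl ∷ []) , tt , tt

oneDim-clauseF : ∀ c → OneDim (clauseF c)
oneDim-clauseF c = atMostOne-[] (fv-clauseF c) , oneDim-violationF c

hasArity-replicate : ∀ {i n} a → i < n → HasArity (replicate n a) i a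
hasArity-replicate {zero}  a (s≤s _)   = here
hasArity-replicate {suc i} a (s≤s i<n) = there (hasArity-replicate a i<n)

AtomBelow : ℕ → Atom → Set
AtomBelow K (s , _) = symArg s ≤ K

ClauseBelow : ℕ → Clause → Set
ClauseBelow K (horn xs x)  = All (AtomBelow K) xs × AtomBelow K x
ClauseBelow K (denial xs)  = All (AtomBelow K) xs
ClauseBelow K (total s s') = symArg s ≤ K × symArg s' ≤ K

module WellFormed {K N : ℕ} (K<N : pair 6 K < N) where

  ar : List ℕ
  ar = replicate N 2

  hasArity-⌜⌝ : ∀ s → symArg s ≤ K → HasArity ar ⌜ s ⌝ 2
  hasArity-⌜⌝ s p = hasArity-replicate 2 (≤-<-trans (⌜⌝≤ s p) K<N)

  wf-conjF : ∀ {xs} φ → All (AtomBelow K) xs → WFFm ar 1 φ → WFFm ar 1 (conjF xs φ)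
  wf-conjF φ [] q = q
  wf-conjF {(s , _) ∷ _} φ (p ∷ ps) q = hasArity-⌜⌝ s p , wf-conjF φ ps q

  wf-violationF : ∀ c → ClauseBelow K c → WFFm ar 1 (violationF c)
  wf-violationF (horn xs x@(s , i , j)) (ps , p) = wf-conjF (notAtomF x) ps
    (hasArity-⌜⌝ E z≤n , hasArity-⌜⌝ s p , here refl ∷ there (here refl) ∷ [])
  wf-violationF (denial xs) ps = wf-conjF (eqF 0 0) ps tt
  wf-violationF (total s s') (p , p') =
    hasArity-⌜⌝ s p , (hasArity-⌜⌝ s' p' , s≤s z≤n) , here refl ∷ here refl ∷ []

  wf-clauseF : ∀ c → ClauseBelow K c → WFFm ar 1 (clauseF c)
  wf-clauseF c p =
    tt , wf-violationF c p , subst (All (_∈ (0 ∷ 0 ∷ []))) (sym (fv-violationF c)) []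

-- Semantics of clauses

module Semantics {A : Set} (M : Structure A) where

  Atom⊨ : (Var → A) → Atom → Set
  Atom⊨ v (s , i , j) = base M ⌜ s ⌝ (v i ∷ v j ∷ [])

  -- The constructive content of having no violation: positive conclusions hold up to double
  -- negation, and for `horn` only at pairs guarded by `E`.
  Clause⊨ : Clause → Set
  Clause⊨ (horn xs x@(_ , i , j)) =
    ∀ v → All (Atom⊨ v) xs → Atom⊨ v (E , i , j) → ¬ ¬ Atom⊨ v x
  Clause⊨ (denial xs)  = ∀ v → ¬ All (Atom⊨ v) xs
  Clause⊨ (total s s') = ∀ x → base M ⌜ s ⌝ (x ∷ x ∷ []) →
    ¬ ¬ Σ A λ y → base M ⌜ s' ⌝ (x ∷ y ∷ []) × dist M 0 x y

  sat-conjF⁻ : ∀ ρ xs {φ} → Sat M ρ (conjF xs φ) → All (Atom⊨ (ρ ∘ toℕ)) xs × Sat M ρ φ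
  sat-conjF⁻ ρ []       p = [] , p
  sat-conjF⁻ ρ (x ∷ xs) (p , q) with sat-conjF⁻ ρ xs q
  ... | ps , r = p ∷ ps , r

  sat-conjF⁺ : ∀ ρ {xs φ} → All (Atom⊨ (ρ ∘ toℕ)) xs → Sat M ρ φ → Sat M ρ (conjF xs φ)
  sat-conjF⁺ ρ []       q = q
  sat-conjF⁺ ρ (p ∷ ps) q = p , sat-conjF⁺ ρ ps q

  assign : (ℕ → A) → (Var → A) → ℕ → A
  assign ρ v = ((((ρ [ 0 ↦ v zero ]) [ 1 ↦ v (suc zero) ]) [ 2 ↦ v (suc (suc zero)) ])
    [ 3 ↦ v (suc (suc (suc zero))) ]) [ 4 ↦ v (suc (suc (suc (suc zero)))) ]

  assign-toℕ : ∀ ρ v i → v i ≡ assign ρ v (toℕ i)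
  assign-toℕ ρ v zero                         = refl
  assign-toℕ ρ v (suc zero)                   = refl
  assign-toℕ ρ v (suc (suc zero))             = refl
  assign-toℕ ρ v (suc (suc (suc zero)))       = refl
  assign-toℕ ρ v (suc (suc (suc (suc zero)))) = refl

  atom-assign : ∀ ρ v x → Atom⊨ v x → Atom⊨ (assign ρ v ∘ toℕ) x
  atom-assign ρ v (s , i , j) =
    subst₂ (λ x y → base M ⌜ s ⌝ (x ∷ y ∷ [])) (assign-toℕ ρ v i) (assign-toℕ ρ v j)

  atom-unassign : ∀ ρ v x → Atom⊨ (assign ρ v ∘ toℕ) x → Atom⊨ v x
  atom-unassign ρ v (s , i , j) =
    subst₂ (λ x y → base M ⌜ s ⌝ (x ∷ y ∷ [])) (sym (assign-toℕ ρ v i)) (sym (assign-toℕ ρ v j))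

  sat-clauseF⁻ : ∀ ρ c → Sat M ρ (clauseF c) → Clause⊨ c
  sat-clauseF⁻ ρ (horn xs x@(_ , i , j)) (r , _ , n) v ps e ¬p =
    -- The five witnesses are the values of `v`, as fixed by `assign ρ' v`; `ρ'` accounts for the
    -- variable bound by `notF`.
    n (_ , _ , _ , _ , _ , sat-conjF⁺ _ (All.map (λ {y} → atom-assign ρ' v y) ps)
      (atom-assign ρ' v (E , i , j) e , ¬p ∘ atom-unassign ρ' v x))
    where ρ' = ρ [ 0 ↦ r ]
  sat-clauseF⁻ ρ (denial xs) (r , _ , n) v ps =
    n (_ , _ , _ , _ , _ , sat-conjF⁺ _ (All.map (λ {y} → atom-assign ρ' v y) ps) refl)
    where ρ' = ρ [ 0 ↦ r ]
  sat-clauseF⁻ ρ (total s s') (r , _ , n) x d ¬p = n (x , d , ¬p)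

  sat-clauseF⁺ : ∀ ρ c → Clause⊨ c → Sat M ρ (clauseF c)
  sat-clauseF⁺ ρ (horn xs x) h = ρ 0 , refl , λ where
    (_ , _ , _ , _ , _ , p) → let ps , e , ¬q = sat-conjF⁻ _ xs p in h _ ps e ¬q
  sat-clauseF⁺ ρ (denial xs) h = ρ 0 , refl , λ where
    (_ , _ , _ , _ , _ , p) → h _ (proj₁ (sat-conjF⁻ _ xs p))
  sat-clauseF⁺ ρ (total s s') h = ρ 0 , refl , λ where
    (x , d , ¬p) → h x d ¬p

-- The theory of a program

pattern x₀ = zero
pattern x₁ = suc zero
pattern x₂ = suc (suc zero)
pattern x₃ = suc (suc (suc zero))
pattern x₄ = suc (suc (suc (suc zero)))

-- Demands `D` pass from a program to its subprograms, and results `R` pass back. Only `leafT` and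
-- `pairT` create trees, so only they have a `total` clause.
ownAxioms axioms : Tm → List Clause
ownAxioms leafT =
  total (D leafT) (R leafT) ∷
  horn ((R leafT , x₀ , x₁) ∷ []) (Leaf , x₁ , x₁) ∷ []
ownAxioms idT =
  horn ((D idT , x₀ , x₀) ∷ []) (R idT , x₀ , x₀) ∷ []
ownAxioms leftT =
  horn ((D leftT , x₀ , x₀) ∷ (Fst , x₀ , x₁) ∷ []) (R leftT , x₀ , x₁) ∷ []
ownAxioms rightT =
  horn ((D rightT , x₀ , x₀) ∷ (Snd , x₀ , x₁) ∷ []) (R rightT , x₀ , x₁) ∷ []
ownAxioms t@(pairT f g) =
  total (D t) (R t) ∷
  horn ((D t , x₀ , x₀) ∷ []) (D f , x₀ , x₀) ∷
  horn ((D t , x₀ , x₀) ∷ []) (D g , x₀ , x₀) ∷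
  horn ((R t , x₀ , x₁) ∷ (R f , x₀ , x₂) ∷ []) (Fst , x₁ , x₂) ∷
  horn ((R t , x₀ , x₁) ∷ (R g , x₀ , x₂) ∷ []) (Snd , x₁ , x₂) ∷ []
ownAxioms t@(compT g f) =
  horn ((D t , x₀ , x₀) ∷ []) (D f , x₀ , x₀) ∷
  horn ((D t , x₀ , x₀) ∷ (R f , x₀ , x₁) ∷ []) (D g , x₁ , x₁) ∷
  horn ((D t , x₀ , x₀) ∷ (R f , x₀ , x₁) ∷ (R g , x₁ , x₂) ∷ []) (R t , x₀ , x₂) ∷ []
ownAxioms t@(whileT f) =
  horn ((D t , x₀ , x₀) ∷ (Fst , x₀ , x₁) ∷ (Leaf , x₁ , x₁) ∷ (Snd , x₀ , x₂) ∷ [])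
    (R t , x₀ , x₂) ∷
  -- A head `x₁` different from a leaf is recognised by its having a first component `x₂`.
  horn ((D t , x₀ , x₀) ∷ (Fst , x₀ , x₁) ∷ (Fst , x₁ , x₂) ∷ []) (D f , x₀ , x₀) ∷
  horn ((D t , x₀ , x₀) ∷ (Fst , x₀ , x₁) ∷ (Fst , x₁ , x₂) ∷ (R f , x₀ , x₃) ∷ [])
    (D t , x₃ , x₃) ∷
  horn ((D t , x₀ , x₀) ∷ (Fst , x₀ , x₁) ∷ (Fst , x₁ , x₂) ∷ (R f , x₀ , x₃) ∷
        (R t , x₃ , x₄) ∷ [])
    (R t , x₀ , x₄) ∷ []

subtermAxioms : Tm → List Clause
axioms t = ownAxioms t ++ subtermAxioms t
subtermAxioms (pairT f g) = axioms f ++ axioms g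
subtermAxioms (compT g f) = axioms g ++ axioms f
subtermAxioms (whileT f)  = axioms f
subtermAxioms _           = []

-- The denial excludes a nonzero result: a nonzero numeral is a node and has a first component,
-- while zero is the leaf.
theory : Tm → List Clause
theory t =
  horn ((Start , x₀ , x₀) ∷ []) (D t , x₀ , x₀) ∷
  denial ((Start , x₀ , x₀) ∷ (R t , x₀ , x₁) ∷ (Fst , x₁ , x₂) ∷ []) ∷
  axioms t

-- Bounds on the symbols of the theory

axioms-below : ∀ {K} t → code t ≤ K → All (ClauseBelow K) (axioms t)
ownAxioms-below : ∀ {K} t → code t ≤ K → All (ClauseBelow K) (ownAxioms t)
subtermAxioms-below : ∀ {K} t → codeArg t ≤ K → All (ClauseBelow K) (subtermAxioms t)

axioms-below t p =
  ++⁺ (ownAxioms-below t p) (subtermAxioms-below t (≤-trans (≤-pairʳ (tag t) (codeArg t)) p))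

ownAxioms-below leafT  p = (p , p) ∷ (p ∷ [] , z≤n) ∷ []
ownAxioms-below idT    p = (p ∷ [] , p) ∷ []
ownAxioms-below leftT  p = (p ∷ z≤n ∷ [] , p) ∷ []
ownAxioms-below rightT p = (p ∷ z≤n ∷ [] , p) ∷ []
ownAxioms-below t@(pairT f g) p =
  (p , p) ∷ (p ∷ [] , f≤) ∷ (p ∷ [] , g≤) ∷ (p ∷ f≤ ∷ [] , z≤n) ∷ (p ∷ g≤ ∷ [] , z≤n) ∷ []
  where
  f≤ = ≤-trans (≤-pairˡ (code f) (code g)) (≤-trans (≤-pairʳ (tag t) (codeArg t)) p)
  g≤ = ≤-trans (≤-pairʳ (code f) (code g)) (≤-trans (≤-pairʳ (tag t) (codeArg t)) p)
ownAxioms-below t@(compT g f) p =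
  (p ∷ [] , f≤) ∷ (p ∷ f≤ ∷ [] , g≤) ∷ (p ∷ f≤ ∷ g≤ ∷ [] , p) ∷ []
  where
  g≤ = ≤-trans (≤-pairˡ (code g) (code f)) (≤-trans (≤-pairʳ (tag t) (codeArg t)) p)
  f≤ = ≤-trans (≤-pairʳ (code g) (code f)) (≤-trans (≤-pairʳ (tag t) (codeArg t)) p)
ownAxioms-below t@(whileT f) p =
  (p ∷ z≤n ∷ z≤n ∷ z≤n ∷ [] , p) ∷
  (p ∷ z≤n ∷ z≤n ∷ [] , f≤) ∷
  (p ∷ z≤n ∷ z≤n ∷ f≤ ∷ [] , p) ∷
  (p ∷ z≤n ∷ z≤n ∷ f≤ ∷ p ∷ [] , p) ∷ []
  where
  f≤ = ≤-trans (≤-pairʳ (tag t) (codeArg t)) p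

subtermAxioms-below leafT  p = []
subtermAxioms-below idT    p = []
subtermAxioms-below leftT  p = []
subtermAxioms-below rightT p = []
subtermAxioms-below (pairT f g) p =
  ++⁺ (axioms-below f (≤-trans (≤-pairˡ (code f) (code g)) p))
      (axioms-below g (≤-trans (≤-pairʳ (code f) (code g)) p))
subtermAxioms-below (compT g f) p =
  ++⁺ (axioms-below g (≤-trans (≤-pairˡ (code g) (code f)) p))
      (axioms-below f (≤-trans (≤-pairʳ (code g) (code f)) p))
subtermAxioms-below (whileT f) p = axioms-below f p

theory-below : ∀ t → All (ClauseBelow (code t)) (theory t)
theory-below t =
  (z≤n ∷ [] , ≤-refl) ∷ (z≤n ∷ ≤-refl ∷ z≤n ∷ []) ∷ axioms-below t ≤-refl

-- The instance

-- Closed, valid, and with a code of size at least n.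
paddingF : ℕ → Fm
paddingF n = exF n (eqF n n)

allF : List Clause → Fm
allF []       = paddingF 0
allF (c ∷ cs) = andF (clauseF c) (allF cs)

-- The padding makes the code of this formula exceed every symbol number of the theory, so this code
-- can serve both as input and as size of the signature.
coreF : Tm → Fm
coreF t = andF (paddingF (suc (pair 6 (code t)))) (allF (theory t))

linkF : Fm
linkF = andF (batom ⌜ Fst ⌝ (0 ∷ 2 ∷ [])) (andF (batom ⌜ Leaf ⌝ (2 ∷ 2 ∷ []))
  (andF (batom ⌜ Snd ⌝ (0 ∷ 1 ∷ [])) (andF (tatom 0 0 2) (tatom 0 0 1))))

-- The element named by variable 0 represents num n.
chainF : ℕ → Fm
chainF zero    = batom ⌜ Leaf ⌝ (0 ∷ 0 ∷ [])
-- Rebinding variable 0 to the tail keeps one free variable per block and lets the code of each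
-- chain be computed from that of the previous one.
chainF (suc n) = exF 1 (exF 2 (andF linkF (exF 0 (andF (eqF 0 1) (chainF n)))))

-- The loop `T₁ x x` places the start element in its own `T₁`-class.
startF : Fm
startF = andF (batom ⌜ Start ⌝ (0 ∷ 0 ∷ [])) (tatom 0 0 0)

inputF : ℕ → Fm
inputF n = exF 0 (andF startF (chainF n))

incs : List (BinSym × BinSym)
incs = (tsym 0 , tsym 1) ∷ (tsym 0 , bsym ⌜ E ⌝) ∷ []

inst : Fm → ℕ → Instance
inst φ n = mkInstance (replicate n 2) 1 (andF φ (inputF n)) incs

-- Well-formedness of the instance

fv-paddingF : ∀ n → fv (paddingF n) ≡ []
fv-paddingF n = ∈[]⇒≡[] (remove-∈ n (here refl ∷ here refl ∷ []))

fv-allF : ∀ cs → fv (allF cs) ≡ []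
fv-allF []       = refl
fv-allF (c ∷ cs) rewrite fv-clauseF c = fv-allF cs

fv-coreF : ∀ t → fv (coreF t) ≡ []
fv-coreF t rewrite fv-paddingF (suc (pair 6 (code t))) = fv-allF (theory t)

fv-chainF : ∀ n → All (_∈ (0 ∷ [])) (fv (chainF n))
fv-chainTail : ∀ n → All (_∈ (1 ∷ [])) (fv (exF 0 (andF (eqF 0 1) (chainF n))))
fv-chainF zero    = here refl ∷ here refl ∷ []
fv-chainF (suc n) = remove-∈ 1 (remove-∈ 2
  (++⁺ {xs = fv linkF}
    (v₀ ∷ v₂ ∷ v₂ ∷ v₂ ∷ v₀ ∷ v₁ ∷ v₀ ∷ v₂ ∷ v₀ ∷ v₁ ∷ [])
    (All.map (λ { (here refl) → v₁ }) (fv-chainTail n))))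
  where
  v₀ : 0 ∈ (2 ∷ 1 ∷ 0 ∷ [])
  v₀ = there (there (here refl))
  v₁ : 1 ∈ (2 ∷ 1 ∷ 0 ∷ [])
  v₁ = there (here refl)
  v₂ : 2 ∈ (2 ∷ 1 ∷ 0 ∷ [])
  v₂ = here refl
fv-chainTail n = remove-∈ 0 {xs = 0 ∷ 1 ∷ fv (chainF n)}
  (here refl ∷ there (here refl) ∷ All.map (λ { (here refl) → here refl }) (fv-chainF n))

fv-inputF : ∀ n → fv (inputF n) ≡ []
fv-inputF n = ∈[]⇒≡[] (remove-∈ 0 {xs = fv startF ++ fv (chainF n)}
  (here refl ∷ here refl ∷ here refl ∷ here refl ∷ fv-chainF n))

oneDim-allF : ∀ cs → OneDim (allF cs)
oneDim-allF []       = atMostOne-[] refl , tt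
oneDim-allF (c ∷ cs) = oneDim-clauseF c , oneDim-allF cs

oneDim-chainF : ∀ n → OneDim (chainF n)
oneDim-chainF zero    = tt
oneDim-chainF (suc n) = atMostOne-∈ (fv-chainF (suc n)) , (tt , tt , tt , tt , tt) ,
  atMostOne-∈ (fv-chainTail n) , tt , oneDim-chainF n

wf-inst : ∀ {n} t → suc (pair 6 (code t)) ≤ n → WFInstance (inst (coreF t) n)
wf-inst {n} t K<n =
  ((tt , wf-allF (theory-below t)) , (hasArity-⌜⌝ Start z≤n , s≤s z≤n) , wf-chainF n) ,
  cong₂ _++_ (fv-coreF t) (fv-inputF n) ,
  (((atMostOne-[] (fv-paddingF (suc (pair 6 (code t)))) , tt) , oneDim-allF (theory t)) ,
   (atMostOne-[] (fv-inputF n) , (tt , tt) , oneDim-chainF n)) ,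
  (s≤s z≤n , s≤s (s≤s z≤n)) ∷ (s≤s z≤n , hasArity-⌜⌝ E z≤n) ∷ []
  where
  open WellFormed {code t} K<n

  wf-allF : ∀ {cs} → All (ClauseBelow (code t)) cs → WFFm ar 1 (allF cs)
  wf-allF []             = tt
  wf-allF {c ∷ _} (p ∷ ps) = wf-clauseF c p , wf-allF ps

  wf-chainF : ∀ m → WFFm ar 1 (chainF m)
  wf-chainF zero    = hasArity-⌜⌝ Leaf z≤n
  wf-chainF (suc m) =
    (hasArity-⌜⌝ Fst z≤n , hasArity-⌜⌝ Leaf z≤n , hasArity-⌜⌝ Snd z≤n , s≤s z≤n , s≤s z≤n) ,
    tt , wf-chainF m

-- Halting with a nonzero value excludes models

-- The double-negation monad: the final goal is a contradiction, so clause conclusions known up to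
-- double negation can be chained by `do`.
_>>=_ : {A B : Set} → ¬ ¬ A → (A → ¬ ¬ B) → ¬ ¬ B
(m >>= k) ¬b = m λ a → k a ¬b

return : {A : Set} → A → ¬ ¬ A
return a ¬a = ¬a a

module Soundness {A : Set} (M : Structure A) (adm : Admissible 1 M)
                 (inc : SatInclusions M incs) where
  open Semantics M

  Holds : Sym → A → A → Set
  Holds s x y = base M ⌜ s ⌝ (x ∷ y ∷ [])

  T : A → A → Set
  T = dist M 0

  T-trans : ∀ {x y z} → T x y → T y z → T x z
  T-trans = proj₁ adm 0 (s≤s z≤n)

  T-sym : ∀ {x y} → T x y → T y x
  T-sym p = proj₁ (proj₂ adm 0 (s≤s z≤n)) (All.lookup inc (here refl) _ _ p)

  T⊆E : ∀ {x y} → T x y → Holds E x y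
  T⊆E = All.lookup inc (there (here refl)) _ _

  module _ (root : A) where

    Near : A → Set
    Near = T root

    guard : ∀ {x y} → Near x → Near y → Holds E x y
    guard p q = T⊆E (T-trans (T-sym p) q)

    -- A relation, since `Fst` and `Snd` need not be functional in an arbitrary model: an element
    -- may represent several trees. The simulation claims only that some element represents the
    -- result.
    Represents : A → Tree → Set
    Represents x leaf       = Holds Leaf x x
    Represents x (node a b) = Σ A λ y → Σ A λ z → Near y × Near z ×
      Holds Fst x y × Holds Snd x z × Represents y a × Represents z b

    val : Vec A 5 → Var → A
    val = Vec.lookup

    -- Induction on the run, each rule being matched by the clauses of its program. `Near` persists
    -- because new elements are components of represented trees or `T₁`-successors given by `total`.
    simulate : All Clause⊨ (axioms t) → Ev P t v w → ∀ {x} → Near x → Holds (D t) x x →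
               Represents x v → ¬ ¬ Σ A λ y → Near y × Holds (R t) x y × Represents y w
    simulate (c₀ ∷ c₁ ∷ _) (ev-leaf _) {x} nx d rx = do
      y , r , xy ← c₀ x d
      let ny = T-trans nx xy
      -- Positions beyond the variables of the clause get the default value `x`.
      l ← c₁ (val (x ∷ y ∷ x ∷ x ∷ x ∷ [])) (r ∷ []) (guard ny ny)
      return (y , ny , r , l)
    simulate (c ∷ _) ev-id {x} nx d rx = do
      r ← c (λ _ → x) (d ∷ []) (guard nx nx)
      return (x , nx , r , rx)
    simulate (c ∷ _) ev-left {x} nx d (y , z , ny , nz , xy , xz , ry , rz) = do
      r ← c (val (x ∷ y ∷ x ∷ x ∷ x ∷ [])) (d ∷ xy ∷ []) (guard nx ny)
      return (y , ny , r , ry)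
    simulate (c ∷ _) ev-right {x} nx d (y , z , ny , nz , xy , xz , ry , rz) = do
      r ← c (val (x ∷ z ∷ x ∷ x ∷ x ∷ [])) (d ∷ xz ∷ []) (guard nx nz)
      return (z , nz , r , rz)
    simulate {t = pairT f g} (c₀ ∷ c₁ ∷ c₂ ∷ c₃ ∷ c₄ ∷ cs) (ev-pair _ e e') {x} nx d rx = do
      d₁ ← c₁ (λ _ → x) (d ∷ []) (guard nx nx)
      d₂ ← c₂ (λ _ → x) (d ∷ []) (guard nx nx)
      y , ny , r₁ , ry ← simulate (++⁻ˡ (axioms f) cs) e nx d₁ rx
      z , nz , r₂ , rz ← simulate (++⁻ʳ (axioms f) cs) e' nx d₂ rx
      p , r , xp ← c₀ x d
      let np = T-trans nx xp
      py ← c₃ (val (x ∷ p ∷ y ∷ x ∷ x ∷ [])) (r ∷ r₁ ∷ []) (guard np ny)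
      pz ← c₄ (val (x ∷ p ∷ z ∷ x ∷ x ∷ [])) (r ∷ r₂ ∷ []) (guard np nz)
      return (p , np , r , y , z , ny , nz , py , pz , ry , rz)
    simulate {t = compT g f} (c₀ ∷ c₁ ∷ c₂ ∷ cs) (ev-comp e e') {x} nx d rx = do
      d₁ ← c₀ (λ _ → x) (d ∷ []) (guard nx nx)
      y , ny , r₁ , ry ← simulate (++⁻ʳ (axioms g) cs) e nx d₁ rx
      d₂ ← c₁ (val (x ∷ y ∷ x ∷ x ∷ x ∷ [])) (d ∷ r₁ ∷ []) (guard ny ny)
      z , nz , r₂ , rz ← simulate (++⁻ˡ (axioms g) cs) e' ny d₂ ry
      r ← c₂ (val (x ∷ y ∷ z ∷ x ∷ x ∷ [])) (d ∷ r₁ ∷ r₂ ∷ []) (guard nx nz)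
      return (z , nz , r , rz)
    simulate (c ∷ _) ev-stop {x} nx d (y , z , ny , nz , xy , xz , ry , rz) = do
      r ← c (val (x ∷ y ∷ z ∷ x ∷ x ∷ [])) (d ∷ xy ∷ ry ∷ xz ∷ []) (guard nx nz)
      return (z , nz , r , rz)
    -- The rest of the loop is a run of the same program, hence the full list `cs₀` is used again;
    -- `y'` certifies that the head is a node.
    simulate cs₀@(_ ∷ c₁ ∷ c₂ ∷ c₃ ∷ cs) (ev-step e e') {x} nx d
             rx@(y , _ , _ , _ , xy , _ , (y' , _ , _ , _ , yy' , _) , _) = do
      d₁ ← c₁ (val (x ∷ y ∷ y' ∷ x ∷ x ∷ [])) (d ∷ xy ∷ yy' ∷ []) (guard nx nx)
      z , nz , r₁ , rz ← simulate cs e nx d₁ rx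
      d₂ ← c₂ (val (x ∷ y ∷ y' ∷ z ∷ x ∷ [])) (d ∷ xy ∷ yy' ∷ r₁ ∷ []) (guard nz nz)
      u , nu , r₂ , ru ← simulate cs₀ e' nz d₂ rz
      r ← c₃ (val (x ∷ y ∷ y' ∷ z ∷ u ∷ [])) (d ∷ xy ∷ yy' ∷ r₁ ∷ r₂ ∷ []) (guard nx nu)
      return (u , nu , r , ru)

    sat-chainF⁻ : ∀ n ρ → Near (ρ 0) → Sat M ρ (chainF n) → Represents (ρ 0) (num n)
    sat-chainF⁻ zero    ρ nx p = p
    sat-chainF⁻ (suc n) ρ nx (z , y , (xy , ly , xz , Txy , Txz) , (z' , refl , p)) =
      y , z , T-trans nx Txy , T-trans nx Txz , xy , xz , ly ,
      sat-chainF⁻ n (((ρ [ 1 ↦ z ]) [ 2 ↦ y ]) [ 0 ↦ z ]) (T-trans nx Txz) p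

  sat-allF⁻ : ∀ cs ρ → Sat M ρ (allF cs) → All Clause⊨ cs
  sat-allF⁻ []       ρ _       = []
  sat-allF⁻ (c ∷ cs) ρ (p , q) = sat-clauseF⁻ ρ c p ∷ sat-allF⁻ cs ρ q

  -- Simulation with the start element as root yields a result with a first component, against the
  -- denial in `theory`.
  nonzero⇒unsat : ∀ t n ρ → Run t (num n) (node a b) →
                  ¬ Sat M ρ (andF (coreF t) (inputF n))
  nonzero⇒unsat t n ρ e ((_ , q) , x , (s , nx) , p) with sat-allF⁻ (theory t) ρ q
  ... | c₀ ∷ c₁ ∷ cs = contra λ ()
    where
    contra : ¬ ¬ ⊥
    contra = do
      d ← c₀ (λ _ → x) (s ∷ []) (guard x nx nx)
      y , ny , r , z , _ , _ , _ , yz , _ ← simulate x cs e nx d (sat-chainF⁻ x n (ρ [ 0 ↦ x ]) nx p)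
      λ _ → c₁ (val x (x ∷ y ∷ z ∷ x ∷ x ∷ [])) (s ∷ r ∷ yz ∷ [])

nonzero⇒¬satisfiable : ∀ t n → Run t (num n) (node a b) → ¬ Satisfiable (inst (coreF t) n)
nonzero⇒¬satisfiable t n e (_ , M , adm , inc , ρ , p) =
  Soundness.nonzero⇒unsat M adm inc t n ρ e p

-- Halting with value zero yields a finite model

-- The subtrees of the input. A run need not create them, so they join the carrier separately.
chainTrees : ℕ → List Tree
chainTrees zero    = leaf ∷ []
chainTrees (suc n) = num (suc n) ∷ chainTrees n

ev-leaf⁻ : Ev P leafT v w → w ≡ leaf
ev-leaf⁻ (ev-leaf _) = refl

ev-pair⁻ˡ : Ev P (pairT f g) v w → Ev P f v a → ∃ λ b → w ≡ node a b
ev-pair⁻ˡ (ev-pair _ d _) d' = _ , cong (λ u → node u _) (ev-deterministic d d')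

ev-pair⁻ʳ : Ev P (pairT f g) v w → Ev P g v b → ∃ λ a → w ≡ node a b
ev-pair⁻ʳ (ev-pair _ _ e) e' = _ , cong (node _) (ev-deterministic e e')

ev-pair-created : Ev P (pairT f g) v w → P w
ev-pair-created (ev-pair p _ _) = p

ev-leaf-created : Ev P leafT v w → P w
ev-leaf-created (ev-leaf p) = p

-- Stated with equations because the trees occur as values of an assignment, not in constructor
-- form.
ev-stop′ : ∀ {u c} → u ≡ node a b → a ≡ leaf → u ≡ node c w → Ev P (whileT f) u w
ev-stop′ refl refl refl = ev-stop

ev-step′ : ∀ {u c d x} → u ≡ node a b → a ≡ node c d → Ev P f u x → Ev P (whileT f) x w →
           Ev P (whileT f) u w
ev-step′ refl refl = ev-step

ev-while⁻ : ∀ {u c d} → u ≡ node a b → a ≡ node c d → Ev P (whileT f) u w →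
            ∃ λ x → Ev P f u x × Ev P (whileT f) x w
ev-while⁻ refl refl (ev-step d e) = _ , d , e

module FiniteModel (t₀ : Tm) (n : ℕ) (L : List Tree) (run : Ev (_∈ L) t₀ (num n) leaf)
                   (chain : All (_∈ L) (chainTrees n)) where

  interp : Sym → Tree → Tree → Set
  interp E     x y = ⊤
  interp Leaf  x y = x ≡ leaf
  interp Fst   x y = ∃ λ z → x ≡ node y z
  interp Snd   x y = ∃ λ z → x ≡ node z y
  interp Start x y = x ≡ num n
  interp (D t) x y = ∃ λ z → Ev (_∈ L) t x z
  interp (R t) x y = Ev (_∈ L) t x y

  -- Quantifying over symbols avoids a decoding function; `⌜⌝-injective` makes the symbol unique.
  interpBase : ℕ → List (Fin (length L)) → Set
  interpBase k (i ∷ j ∷ []) = Σ Sym λ s → k ≡ ⌜ s ⌝ × interp s (lookup L i) (lookup L j)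
  interpBase _ _            = ⊥

  M : Structure (Fin (length L))
  -- The full relation is transitive, is its own inverse and is contained in `E`, which is full as
  -- well.
  M = record { base = interpBase ; dist = λ _ _ _ → ⊤ }

  open Semantics M

  base⁺ : ∀ s {i j} → interp s (lookup L i) (lookup L j) → base M ⌜ s ⌝ (i ∷ j ∷ [])
  base⁺ s p = s , refl , p

  base⁻ : ∀ s {i j} → base M ⌜ s ⌝ (i ∷ j ∷ []) → interp s (lookup L i) (lookup L j)
  base⁻ s (s' , e , p) with ⌜⌝-injective s s' e
  ... | refl = p

  AtomTrue : (Var → Tree) → Atom → Set
  AtomTrue v (s , i , j) = interp s (v i) (v j)

  -- Truth over all trees. Universal clauses survive the restriction to `L`, so only `total` has to
  -- place its witness in `L`.
  ClauseTrue : Clause → Set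
  ClauseTrue (horn xs x)  = ∀ v → All (AtomTrue v) xs → AtomTrue v x
  ClauseTrue (denial xs)  = ∀ v → ¬ All (AtomTrue v) xs
  ClauseTrue (total s s') = ∀ x → interp s x x → Σ Tree λ y → y ∈ L × interp s' x y

  atoms⁻ : ∀ {v xs} → All (Atom⊨ v) xs → All (AtomTrue (lookup L ∘ v)) xs
  atoms⁻ = All.map λ { {s , _} → base⁻ s }

  clause⁺ : ∀ c → ClauseTrue c → Clause⊨ c
  clause⁺ (horn xs (s , _)) h v ps _ ¬p = ¬p (base⁺ s (h _ (atoms⁻ ps)))
  clause⁺ (denial xs)       h v ps      = h _ (atoms⁻ ps)
  clause⁺ (total s s')      h x d ¬p with h _ (base⁻ s d)
  ... | y , y∈L , r =
    ¬p (index y∈L , base⁺ s' (subst (interp s' (lookup L x)) (lookup-index y∈L) r) , tt)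

  ownAxioms-true : ∀ t → All ClauseTrue (ownAxioms t)
  ownAxioms-true leafT =
    (λ { x (y , e) → y , ev-leaf-created e , e }) ∷
    (λ { v (e ∷ []) → ev-leaf⁻ e }) ∷ []
  ownAxioms-true idT = (λ _ _ → ev-id) ∷ []
  ownAxioms-true leftT =
    (λ { v (_ ∷ (_ , e) ∷ []) → subst (λ u → Ev _ leftT u (v x₁)) (sym e) ev-left }) ∷ []
  ownAxioms-true rightT =
    (λ { v (_ ∷ (_ , e) ∷ []) → subst (λ u → Ev _ rightT u (v x₁)) (sym e) ev-right }) ∷ []
  ownAxioms-true (pairT f g) =
    (λ { x (y , e) → y , ev-pair-created e , e }) ∷
    (λ { v ((_ , ev-pair _ d e) ∷ []) → _ , d }) ∷
    (λ { v ((_ , ev-pair _ d e) ∷ []) → _ , e }) ∷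
    (λ { v (p ∷ d ∷ []) → ev-pair⁻ˡ p d }) ∷
    (λ { v (p ∷ e ∷ []) → ev-pair⁻ʳ p e }) ∷ []
  ownAxioms-true (compT g f) =
    (λ { v ((_ , ev-comp d e) ∷ []) → _ , d }) ∷
    -- Determinism identifies the intermediate value in the clause with that of the halting run.
    (λ { v ((_ , ev-comp d e) ∷ d' ∷ []) →
         _ , subst (λ u → Ev _ g u _) (ev-deterministic d d') e }) ∷
    (λ { v (_ ∷ d ∷ e ∷ []) → ev-comp d e }) ∷ []
  ownAxioms-true (whileT f) =
    (λ { v (_ ∷ (_ , p) ∷ q ∷ (_ , p') ∷ []) → ev-stop′ p q p' }) ∷
    (λ { v ((_ , d) ∷ (_ , p) ∷ (_ , q) ∷ []) →
         let _ , e , _ = ev-while⁻ p q d in _ , e }) ∷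
    (λ { v ((_ , d) ∷ (_ , p) ∷ (_ , q) ∷ e ∷ []) →
         let _ , e' , d' = ev-while⁻ p q d
         in _ , subst (λ u → Ev _ (whileT f) u _) (ev-deterministic e' e) d' }) ∷
    (λ { v (_ ∷ (_ , p) ∷ (_ , q) ∷ e ∷ d ∷ []) → ev-step′ p q e d }) ∷ []

  axioms-true : ∀ t → All ClauseTrue (axioms t)
  axioms-true leafT         = ++⁺ (ownAxioms-true leafT) []
  axioms-true idT           = ++⁺ (ownAxioms-true idT) []
  axioms-true leftT         = ++⁺ (ownAxioms-true leftT) []
  axioms-true rightT        = ++⁺ (ownAxioms-true rightT) []
  axioms-true t@(pairT f g) = ++⁺ (ownAxioms-true t) (++⁺ (axioms-true f) (axioms-true g))
  axioms-true t@(compT g f) = ++⁺ (ownAxioms-true t) (++⁺ (axioms-true g) (axioms-true f))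
  axioms-true t@(whileT f)  = ++⁺ (ownAxioms-true t) (axioms-true f)

  -- The given run meets the demand at `num n`; by determinism the result is `leaf`, which has no
  -- first component.
  theory-true : All ClauseTrue (theory t₀)
  theory-true =
    (λ { v (s ∷ []) → leaf , subst (λ u → Ev _ t₀ u leaf) (sym s) run }) ∷
    (λ { v (s ∷ r ∷ (_ , p) ∷ []) → leaf≢node
         (trans (ev-deterministic run (subst (λ u → Ev _ t₀ u (v x₁)) s r)) p) }) ∷
    axioms-true t₀
    where
    leaf≢node : ¬ leaf ≡ node a b
    leaf≢node ()

  sat-allF⁺ : ∀ {cs} ρ → All ClauseTrue cs → Sat M ρ (allF cs)
  sat-allF⁺ ρ []               = ρ 0 , refl
  sat-allF⁺ {c ∷ _} ρ (p ∷ ps) = sat-clauseF⁺ ρ c (clause⁺ c p) , sat-allF⁺ ρ ps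

  leaf∈ : ∀ m → All (_∈ L) (chainTrees m) → leaf ∈ L
  leaf∈ zero    (p ∷ []) = p
  leaf∈ (suc m) (_ ∷ ps) = leaf∈ m ps

  num∈ : ∀ m → All (_∈ L) (chainTrees m) → num m ∈ L
  num∈ zero    (p ∷ _) = p
  num∈ (suc m) (p ∷ _) = p

  sat-chainF⁺ : ∀ m ρ → All (_∈ L) (chainTrees m) → num m ≡ lookup L (ρ 0) →
                Sat M ρ (chainF m)
  sat-chainF⁺ zero    ρ _        e = base⁺ Leaf (sym e)
  sat-chainF⁺ (suc m) ρ (_ ∷ ps) e =
    index z∈ , index y∈ ,
    (base⁺ Fst (_ , trans (sym e) (cong (λ u → node u (num m)) (lookup-index y∈))) ,
     base⁺ Leaf (sym (lookup-index y∈)) ,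
     base⁺ Snd (_ , trans (sym e) (cong (node leaf) (lookup-index z∈))) , tt , tt) ,
    index z∈ , refl , sat-chainF⁺ m (((ρ [ 1 ↦ index z∈ ]) [ 2 ↦ index y∈ ]) [ 0 ↦ index z∈ ]) ps
      (lookup-index z∈)
    where
    y∈ = leaf∈ m ps
    z∈ = num∈ m ps

  finSatisfiable : FinSatisfiable (inst (coreF t₀) n)
  finSatisfiable = length L , M ,
    ((λ _ _ _ _ → tt) , λ _ _ → (λ _ → tt) , (λ _ → tt)) ,
    (λ _ _ _ → tt) ∷ (λ _ _ _ → base⁺ E tt) ∷ [] ,
    (λ _ → x) ,
    ((x , refl) , sat-allF⁺ (λ _ → x) theory-true) ,
    x , (base⁺ Start (sym (lookup-index n∈)) , tt) , sat-chainF⁺ n ((λ _ → x) [ 0 ↦ x ]) chain (lookup-index n∈)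
    where
    n∈ = num∈ n chain
    x  = index n∈

zero⇒finSatisfiable : ∀ t n → Run t (num n) leaf → FinSatisfiable (inst (coreF t) n)
zero⇒finSatisfiable t n d with run-support d
... | L , e = FiniteModel.finSatisfiable t n (L ++ chainTrees n) (ev-map ∈-++⁺ˡ e)
  (All.tabulate (∈-++⁺ʳ L))

-- The instance is computable from the code of its core

abstract
  -- Opaque, because the constants used include codes of formulas, which are huge numbers.
  constP : ∀ {n} → ℕ → PR n
  constP zero    = zeroF
  constP (suc k) = comp succF (constP k ∷ [])

  eval-const : ∀ {n} {xs : Vec ℕ n} k → Eval (constP k) xs k
  eval-const zero    = ev-zero
  eval-const (suc k) = ev-comp (ev-∷ (eval-const k) ev-[]) ev-succ

sucP : ∀ {n} → PR n → PR n
sucP p = comp succF (p ∷ [])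

eval-suc : ∀ {n k} {p : PR n} {xs} → Eval p xs k → Eval (sucP p) xs (suc k)
eval-suc d = ev-comp (ev-∷ d ev-[]) ev-succ

doubleP : PR 1
doubleP = prec zeroF (sucP (sucP (proj (suc zero))))

eval-double : ∀ k → Eval doubleP (k ∷ []) (2 * k)
eval-double zero    = ev-prec-zero ev-zero
eval-double (suc k) = ev-prec-suc (eval-double k)
  (subst (λ m → Eval (sucP (sucP (proj (suc zero)))) (k ∷ 2 * k ∷ []) (suc m)) (sym (+-suc k _))
    (eval-suc (eval-suc (ev-proj (suc zero)))))

pairingP : PR 2
pairingP = prec doubleP (sucP (comp doubleP (proj (suc zero) ∷ [])))

eval-pairing : ∀ a b → Eval pairingP (a ∷ b ∷ []) (pair a b)
eval-pairing zero    b =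
  ev-prec-zero (subst (Eval doubleP (b ∷ [])) (sym (pair-zero b)) (eval-double b))
eval-pairing (suc a) b = ev-prec-suc (eval-pairing a b)
  (subst (Eval (sucP (comp doubleP (proj (suc zero) ∷ []))) (a ∷ pair a b ∷ b ∷ [])) (sym (pair-suc a b))
    (eval-suc (ev-comp (ev-∷ (ev-proj (suc zero)) ev-[]) (eval-double (pair a b)))))

pairP : ∀ {n} → PR n → PR n → PR n
pairP p q = comp pairingP (p ∷ q ∷ [])

eval-pair : ∀ {n} {p q : PR n} {xs} a b →
            Eval p xs a → Eval q xs b → Eval (pairP p q) xs (pair a b)
eval-pair a b d e = ev-comp (ev-∷ d (ev-∷ e ev-[])) (eval-pairing a b)

-- A data type rather than a function, so that φ can be inferred from it.
data Prints {n} (p : PR n) (xs : Vec ℕ n) (φ : Fm) : Set where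
  prints : Eval p xs (codeFm φ) → Prints p xs φ

eval-prints : ∀ {n} {p : PR n} {xs φ} → Prints p xs φ → Eval p xs (codeFm φ)
eval-prints (prints d) = d

exP : ∀ {n} → ℕ → PR n → PR n
exP x p = pairP (constP 5) (pairP (constP x) p)

andP : ∀ {n} → PR n → PR n → PR n
andP p q = pairP (constP 3) (pairP p q)

prints-const : ∀ {n} {xs : Vec ℕ n} φ → Prints (constP (codeFm φ)) xs φ
prints-const φ = prints (eval-const (codeFm φ))

prints-ex : ∀ {n φ} {p : PR n} {xs} x → Prints p xs φ → Prints (exP x p) xs (exF x φ)
prints-ex {φ = φ} x (prints d) =
  prints (eval-pair 5 (pair x (codeFm φ)) (eval-const 5) (eval-pair x (codeFm φ) (eval-const x) d))

prints-and : ∀ {n φ ψ} {p q : PR n} {xs} →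
             Prints p xs φ → Prints q xs ψ → Prints (andP p q) xs (andF φ ψ)
prints-and {φ = φ} {ψ} (prints d) (prints e) =
  prints (eval-pair 3 (pair (codeFm φ) (codeFm ψ)) (eval-const 3)
    (eval-pair (codeFm φ) (codeFm ψ) d e))

-- The recursion step of `chainP`: the second argument, the code of the previous chain, is wrapped
-- into one more link.
linkP : PR 2
linkP = exP 1 (exP 2 (andP (constP (codeFm linkF))
  (exP 0 (andP (constP (codeFm (eqF 0 1))) (proj (suc zero))))))

chainP : PR 1
chainP = prec (constP (codeFm (chainF 0))) linkP

prints-link : ∀ k φ → Prints linkP (k ∷ codeFm φ ∷ [])
                        (exF 1 (exF 2 (andF linkF (exF 0 (andF (eqF 0 1) φ)))))
prints-link k φ = prints-ex 1 (prints-ex 2 (prints-and (prints-const linkF)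
  (prints-ex 0 (prints-and (prints-const (eqF 0 1)) (prints {φ = φ} (ev-proj (suc zero)))))))

eval-chain : ∀ k → Eval chainP (k ∷ []) (codeFm (chainF k))
eval-chain zero    = ev-prec-zero (eval-const (codeFm (chainF 0)))
eval-chain (suc k) = ev-prec-suc (eval-chain k) (eval-prints (prints-link k (chainF k)))

aritiesP : PR 1
aritiesP = prec zeroF (sucP (pairP (constP 2) (proj (suc zero))))

eval-arities : ∀ k → Eval aritiesP (k ∷ []) (codeList (replicate k 2))
eval-arities zero    = ev-prec-zero ev-zero
eval-arities (suc k) = ev-prec-suc (eval-arities k)
  (eval-suc (eval-pair 2 (codeList (replicate k 2)) (eval-const 2) (ev-proj (suc zero))))

formulaP : PR 1
formulaP = andP (proj zero) (exP 0 (andP (constP (codeFm startF)) chainP))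

prints-formula : ∀ φ → Prints formulaP (codeFm φ ∷ []) (andF φ (inputF (codeFm φ)))
prints-formula φ = prints-and (prints {φ = φ} (ev-proj zero))
  (prints-ex 0 (prints-and (prints-const startF) (prints (eval-chain (codeFm φ)))))

instanceP : ∀ {n} → PR n → PR n → PR n → PR n → PR n
instanceP p₁ p₂ p₃ p₄ = pairP p₁ (pairP p₂ (pairP p₃ p₄))

eval-instance : ∀ {n} {p₁ p₂ p₃ p₄ : PR n} {xs} ar k φ is →
  Eval p₁ xs (codeList ar) → Eval p₂ xs k → Prints p₃ xs φ → Eval p₄ xs (codeIncs is) →
  Eval (instanceP p₁ p₂ p₃ p₄) xs (codeInstance (mkInstance ar k φ is))
eval-instance ar k φ is d₁ d₂ (prints d₃) d₄ =
  eval-pair (codeList ar) (pair k (pair (codeFm φ) (codeIncs is))) d₁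
    (eval-pair k (pair (codeFm φ) (codeIncs is)) d₂ (eval-pair (codeFm φ) (codeIncs is) d₃ d₄))

-- The argument is used in three roles: as code of the core, as number of base symbols and as input
-- number.
instP : PR 1
instP = instanceP aritiesP (constP 1) formulaP (constP (codeIncs incs))

eval-inst : ∀ φ → Eval instP (codeFm φ ∷ []) (codeInstance (inst φ (codeFm φ)))
eval-inst φ = eval-instance (replicate (codeFm φ) 2) 1 (andF φ (inputF (codeFm φ))) incs
  (eval-arities (codeFm φ)) (eval-const 1) (prints-formula φ) (eval-const (codeIncs incs))

-- Diagonalisation

codeFm-exF-≥ : ∀ x φ → x ≤ codeFm (exF x φ)
codeFm-exF-≥ x φ = ≤-trans (≤-pairˡ x (codeFm φ)) (≤-pairʳ 5 (pair x (codeFm φ)))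

codeFm-andF-≥ : ∀ φ ψ → codeFm φ ≤ codeFm (andF φ ψ)
codeFm-andF-≥ φ ψ =
  ≤-trans (≤-pairˡ (codeFm φ) (codeFm ψ)) (≤-pairʳ 3 (pair (codeFm φ) (codeFm ψ)))

codeFm-coreF-≥ : ∀ t → suc (pair 6 (code t)) ≤ codeFm (coreF t)
codeFm-coreF-≥ t = ≤-trans (codeFm-exF-≥ m (eqF m m))
  (codeFm-andF-≥ (paddingF m) (allF (theory t)))
  where m = suc (pair 6 (code t))

module Diagonal (p : PR 1) where

  -- On the code of a core φ, runs p on the instance made from φ and its own code.
  diagonal : Tm
  diagonal = compT (compile (comp p (instP ∷ []))) (pairT idT leafT)

  c : ℕ
  c = codeFm (coreF diagonal)

  I : Instance
  I = inst (coreF diagonal) c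

  wf-I : WFInstance I
  wf-I = wf-inst diagonal (codeFm-coreF-≥ diagonal)

  run-diagonal : ∀ {y} → Eval p (codeInstance I ∷ []) y → Run diagonal (num c) (num y)
  run-diagonal d = ev-comp (run-pair ev-id (ev-leaf tt))
    (run-compile {xs = c ∷ []} (ev-comp (ev-∷ (eval-inst (coreF diagonal)) ev-[]) d))

  accepted⇒¬satisfiable : Eval p (codeInstance I ∷ []) 1 → ¬ Satisfiable I
  accepted⇒¬satisfiable d = nonzero⇒¬satisfiable diagonal c (run-diagonal d)

  rejected⇒finSatisfiable : Eval p (codeInstance I ∷ []) 0 → FinSatisfiable I
  rejected⇒finSatisfiable d = zero⇒finSatisfiable diagonal c (run-diagonal d)

fin⇒sat : ∀ I → FinSatisfiable I → Satisfiable I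
fin⇒sat I (n , m) = Fin n , m

-- Covers every property between the two satisfiability notions. Answer 1 would exclude models, so
-- `Prop I` is refuted first; then the answer must be 0, which produces a finite model. No case
-- distinction on `Prop I` is made.
undecidable : (Prop : Instance → Set₁) → (∀ I → FinSatisfiable I → Prop I) →
              (∀ I → Prop I → Satisfiable I) → ¬ Decidable Prop
undecidable Prop fin⇒ ⇒sat (p , decides) =
  ¬holds (fin⇒ I (rejected⇒finSatisfiable (proj₂ (decides I wf-I) ¬holds)))
  where
  open Diagonal p
  ¬holds : ¬ Prop I
  ¬holds h = accepted⇒¬satisfiable (proj₁ (decides I wf-I) h) (⇒sat I h)

theorem31 : ¬ Decidable Satisfiable × ¬ Decidable FinSatisfiable
theorem31 = undecidable Satisfiable fin⇒sat (λ _ → id) ,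
            undecidable FinSatisfiable (λ _ → id) fin⇒sat
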